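{- Let $b,n$ be positive integers with $b+1\leq n$. Then: \begin{itemize} \item if $n\geq 3b+2$, then $p_{b+1,n}>p_{b,n}$; \item if $n\leq 3b+1$, then $p_{b+1,n}<p_{b,n}$. \end{itemize}
   Context: For positive integers $b\leq n$, let $\xi_{b,n}$ be a binomial random variable with parameters $n$ and $b/n$ (number of trials $n$, success probability $b/n$), and let $p_{b,n}:={\sf P}(\xi_{b,n}<b)=\sum_{i=0}^{b-1}\binom{n}{i}(b/n)^i(1-b/n)^{n-i}$. -}

module Defs where

open import Data.Nat as ℕ using (ℕ; zero; suc)
open import Data.Nat.Combinatorics using (_C_)
open import Data.Integer using (+_)
open import Data.Rational using (ℚ; _/_; _+_; _*_; _-_; 0ℚ; 1ℚ)

_^ℚ_ : ℚ → ℕ → ℚ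
x ^ℚ zero  = 1ℚ
x ^ℚ suc k = x * (x ^ℚ k)

ℕ→ℚ : ℕ → ℚ
ℕ→ℚ k = + k / 1

binomPmf : ℕ → ℚ → ℕ → ℚ
binomPmf n q i = ℕ→ℚ (n C i) * ((q ^ℚ i) * ((1ℚ - q) ^ℚ (n ℕ.∸ i)))

sumBelow : ℕ → (ℕ → ℚ) → ℚ
sumBelow zero    f = 0ℚ
sumBelow (suc k) f = sumBelow k f + f k

-- p_{b,n} = P(ξ_{b,n} < b), ξ_{b,n} ~ Bin(n, b/n).  (n = 0 is meaningless; set to 0.)
p : ℕ → ℕ → ℚ
p b zero    = 0ℚ
p b (suc m) = sumBelow b (binomPmf (suc m) (+ b / suc m))

{-# OPTIONS --safe #-}

-- Put m = n - b - 1 and Φ(u) = P(Bin(n, (b + u)/n) ≤ b).  Then p_{b+1,n} = Φ(1) and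
-- p_{b,n} = Φ(0) - K with K = P(ξ_{b,n} = b), while Φ′ = - K f for the density
--   f(u) = (1 + u/b)^b (1 - u/(m + 1))^m.
-- So p_{b+1,n} - p_{b,n} = K (1 - ∫₀¹ f), and since f decreases in m only m = 2b and
-- m = 2b + 1 matter.  There f is nearly a b-th power (1 + z)^b with z of order 1/b²:
--   m = 2b:      with ρ = 1/(2b + 1), Bernoulli's inequality (1 + z)^b ≥ 1 + bz gives
--                ∫ f ≥ 1 + ρ²/12;
--   m = 2b + 1:  with κ = 1/(2b + 2), (1 + z)^b ≤ 1 + bz + (bz)² for bz ≤ 1 gives
--                ∫ f ≤ 1 - κ² (1/24 + (1 - κ)/20).
-- Integrals of polynomials are compared by the mean value inequality on [0, 1] ∩ ℚ.
module Submission where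

open import Defs
open import Data.Nat as ℕ using (ℕ; zero; suc)
import Data.Nat.Properties as ℕ
import Data.Nat.Tactic.RingSolver as ℕ-Solver
open import Data.Nat.Combinatorics using (_C_; nC1≡n; nCk+nC[k+1]≡[n+1]C[k+1])
open import Data.Integer as ℤ using () renaming (+_ to pos)
import Data.Integer.Properties as ℤ
open import Data.Product using (∃; _×_; _,_)
open import Data.Rational hiding (pos)
open import Data.Rational.Properties
import Data.Rational.Unnormalised as ℚᵘ
import Data.Rational.Unnormalised.Properties as ℚᵘ
open import Data.Sum using (_⊎_; inj₁; inj₂)
open import Relation.Binary.PropositionalEquality
open import Relation.Nullary.Decidable using (dec⇒maybe)
open import Tactic.RingSolver using (solve-∀)
open import Tactic.RingSolver.Core.AlmostCommutativeRing using (AlmostCommutativeRing; fromCommutativeRing)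

-- Ring solver and order tools for ℚ.

ℚ-ring : AlmostCommutativeRing _ _
ℚ-ring = fromCommutativeRing +-*-commutativeRing (λ x → dec⇒maybe (0ℚ ≟ x))

0≤1 : 0ℚ ≤ 1ℚ
0≤1 = nonNegative⁻¹ 1ℚ

0≤+ : ∀ {x y} → 0ℚ ≤ x → 0ℚ ≤ y → 0ℚ ≤ x + y
0≤+ {x} {y} 0≤x 0≤y = nonNegative⁻¹ (x + y)
  {{nonNeg+nonNeg⇒nonNeg x {{nonNegative 0≤x}} y {{nonNegative 0≤y}}}}

0≤* : ∀ {x y} → 0ℚ ≤ x → 0ℚ ≤ y → 0ℚ ≤ x * y
0≤* {x} {y} 0≤x 0≤y = nonNegative⁻¹ (x * y)
  {{nonNeg*nonNeg⇒nonNeg x {{nonNegative 0≤x}} y {{nonNegative 0≤y}}}}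

0<* : ∀ {x y} → 0ℚ < x → 0ℚ < y → 0ℚ < x * y
0<* {x} {y} 0<x 0<y = positive⁻¹ (x * y) {{pos*pos⇒pos x {{positive 0<x}} y {{positive 0<y}}}}

-- Turns an inequality into an identity for the ring solver: the gap d is given in a form whose sign
-- is visible, and only `x + d ≡ y` remains to be checked.
≤-by : ∀ {x y d} → 0ℚ ≤ d → x + d ≡ y → x ≤ y
≤-by {x} {d = d} 0≤d refl = subst (_≤ x + d) (+-identityʳ x) (+-monoʳ-≤ x 0≤d)

<-by : ∀ {x y d} → 0ℚ < d → x + d ≡ y → x < y
<-by {x} {d = d} 0<d refl = subst (_< x + d) (+-identityʳ x) (+-monoʳ-< x 0<d)

0<+ : ∀ {x y} → 0ℚ < x → 0ℚ ≤ y → 0ℚ < x + y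
0<+ 0<x 0≤y = <-≤-trans 0<x (≤-by 0≤y refl)

0≤y-x : ∀ {x y} → x ≤ y → 0ℚ ≤ y - x
0≤y-x {x} {y} x≤y = subst (_≤ y - x) (+-inverseʳ x) (+-monoˡ-≤ (- x) x≤y)

0<y-x : ∀ {x y} → x < y → 0ℚ < y - x
0<y-x {x} {y} x<y = subst (_< y - x) (+-inverseʳ x) (+-monoˡ-< (- x) x<y)

*-mono-≤ : ∀ {x y u v} → 0ℚ ≤ x → 0ℚ ≤ v → x ≤ y → u ≤ v → x * u ≤ y * v
*-mono-≤ {x} {y} {u} {v} 0≤x 0≤v x≤y u≤v = ≤-trans
  (*-monoˡ-≤-nonNeg x {{nonNegative 0≤x}} u≤v)
  (*-monoʳ-≤-nonNeg v {{nonNegative 0≤v}} x≤y)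

-- The embedding of ℕ into ℚ, reciprocals, and the Archimedean property.

ℕ→ℚ-+ : ∀ a b → ℕ→ℚ (a ℕ.+ b) ≡ ℕ→ℚ a + ℕ→ℚ b
-- Unnormalised rationals bypass the gcd hidden in `_/_`.
ℕ→ℚ-+ a b = toℚᵘ-injective (begin
  toℚᵘ (ℕ→ℚ (a ℕ.+ b))
    ≈⟨ toℚᵘ-fromℚᵘ _ ⟩
  ℚᵘ.mkℚᵘ (pos (a ℕ.+ b)) 0
    ≈⟨ ℚᵘ.*≡* (cong (ℤ._* pos 1) (cong₂ ℤ._+_ (sym (ℤ.*-identityʳ (pos a))) (sym (ℤ.*-identityʳ (pos b))))) ⟩
  ℚᵘ.mkℚᵘ (pos a) 0 ℚᵘ.+ ℚᵘ.mkℚᵘ (pos b) 0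
    ≈⟨ ℚᵘ.+-cong (toℚᵘ-fromℚᵘ (ℚᵘ.mkℚᵘ (pos a) 0)) (toℚᵘ-fromℚᵘ (ℚᵘ.mkℚᵘ (pos b) 0)) ⟨
  toℚᵘ (ℕ→ℚ a) ℚᵘ.+ toℚᵘ (ℕ→ℚ b)
    ≈⟨ toℚᵘ-homo-+ (ℕ→ℚ a) (ℕ→ℚ b) ⟨
  toℚᵘ (ℕ→ℚ a + ℕ→ℚ b) ∎)
  where open ℚᵘ.≃-Reasoning

ℕ→ℚ-* : ∀ a b → ℕ→ℚ (a ℕ.* b) ≡ ℕ→ℚ a * ℕ→ℚ b
ℕ→ℚ-* zero    b = sym (*-zeroˡ (ℕ→ℚ b))
ℕ→ℚ-* (suc a) b = begin
  ℕ→ℚ (b ℕ.+ a ℕ.* b)        ≡⟨ ℕ→ℚ-+ b (a ℕ.* b) ⟩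
  ℕ→ℚ b + ℕ→ℚ (a ℕ.* b)      ≡⟨ cong (ℕ→ℚ b +_) (ℕ→ℚ-* a b) ⟩
  ℕ→ℚ b + ℕ→ℚ a * ℕ→ℚ b      ≡⟨ factor (ℕ→ℚ a) (ℕ→ℚ b) ⟩
  (1ℚ + ℕ→ℚ a) * ℕ→ℚ b       ≡⟨ cong (_* ℕ→ℚ b) (ℕ→ℚ-+ 1 a) ⟨
  ℕ→ℚ (suc a) * ℕ→ℚ b        ∎
  where
  open ≡-Reasoning
  factor : ∀ x y → y + x * y ≡ (1ℚ + x) * y
  factor = solve-∀ ℚ-ring

ℕ→ℚ-suc : ∀ a → ℕ→ℚ (suc a) ≡ 1ℚ + ℕ→ℚ a
ℕ→ℚ-suc = ℕ→ℚ-+ 1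

0≤ℕ→ℚ : ∀ a → 0ℚ ≤ ℕ→ℚ a
0≤ℕ→ℚ a = nonNegative⁻¹ (ℕ→ℚ a) {{normalize-nonNeg a 1}}

0<ℕ→ℚ : ∀ a .{{_ : ℕ.NonZero a}} → 0ℚ < ℕ→ℚ a
0<ℕ→ℚ a = positive⁻¹ (ℕ→ℚ a) {{normalize-pos a 1}}

-- The shifted index keeps the denominator nonzero by construction: with b = b′ + 1, `recip b′` is
-- 1/b, while `recip m` is 1/(m + 1).
recip : ℕ → ℚ
recip k = pos 1 / suc k

/≡*recip : ∀ a k → pos a / suc k ≡ ℕ→ℚ a * recip k
/≡*recip a k = toℚᵘ-injective (begin
  toℚᵘ (pos a / suc k)
    ≈⟨ toℚᵘ-fromℚᵘ (ℚᵘ.mkℚᵘ (pos a) k) ⟩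
  ℚᵘ.mkℚᵘ (pos a) k
    ≈⟨ ℚᵘ.*≡* (cong₂ ℤ._*_ (sym (ℤ.*-identityʳ (pos a))) (cong pos (ℕ.+-identityʳ (suc k)))) ⟩
  ℚᵘ.mkℚᵘ (pos a) 0 ℚᵘ.* ℚᵘ.mkℚᵘ (pos 1) k
    ≈⟨ ℚᵘ.*-cong (toℚᵘ-fromℚᵘ (ℚᵘ.mkℚᵘ (pos a) 0)) (toℚᵘ-fromℚᵘ (ℚᵘ.mkℚᵘ (pos 1) k)) ⟨
  toℚᵘ (ℕ→ℚ a) ℚᵘ.* toℚᵘ (recip k)
    ≈⟨ toℚᵘ-homo-* (ℕ→ℚ a) (recip k) ⟨
  toℚᵘ (ℕ→ℚ a * recip k) ∎)
  where open ℚᵘ.≃-Reasoning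

n/n≡1 : ∀ k → pos (suc k) / suc k ≡ 1ℚ
n/n≡1 k = toℚᵘ-injective (ℚᵘ.≃-trans (toℚᵘ-fromℚᵘ (ℚᵘ.mkℚᵘ (pos (suc k)) k))
  (ℚᵘ.*≡* (ℤ.*-comm (pos (suc k)) (pos 1))))

suc*recip : ∀ k → ℕ→ℚ (suc k) * recip k ≡ 1ℚ
suc*recip k = trans (sym (/≡*recip (suc k) k)) (n/n≡1 k)

0<recip : ∀ k → 0ℚ < recip k
0<recip k = positive⁻¹ (recip k) {{normalize-pos 1 (suc k)}}

-- Since the denominator is at least 1, the absolute value of the numerator plus 1 already exceeds
-- x.
archimedean : ∀ x → ∃ λ k → x < ℕ→ℚ (suc k)
archimedean x@(mkℚ n d-1 _) = k , toℚᵘ-cancel-< (ℚᵘ.<-respʳ-≃ (ℚᵘ.≃-sym (toℚᵘ-fromℚᵘ (ℚᵘ.mkℚᵘ (pos (suc k)) 0)))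
  (ℚᵘ.*<* (begin-strict
    n ℤ.* pos 1                    ≡⟨ ℤ.*-identityʳ n ⟩
    n                              ≤⟨ i≤∣i∣ n ⟩
    pos k                          <⟨ ℤ.+<+ (ℕ.n<1+n k) ⟩
    pos (suc k)                    ≤⟨ ℤ.+≤+ (ℕ.m≤m*n (suc k) (suc d-1)) ⟩
    pos (suc k ℕ.* suc d-1)        ≡⟨ ℤ.pos-* (suc k) (suc d-1) ⟩
    pos (suc k) ℤ.* pos (suc d-1)  ∎)))
  where
  k = ℤ.∣ n ∣
  open ℤ.≤-Reasoning
  i≤∣i∣ : ∀ i → i ℤ.≤ pos ℤ.∣ i ∣
  i≤∣i∣ (pos _) = ℤ.≤-refl
  i≤∣i∣ ℤ.-[1+ _ ] = ℤ.-≤+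

-- Bounded functions and differentiation on [0, 1].

∣x∣≤K⇒x≤K : ∀ {x K} → ∣ x ∣ ≤ K → x ≤ K
∣x∣≤K⇒x≤K {x} = ≤-trans (x≤∣x∣ (≤-total 0ℚ x))
  where
  x≤∣x∣ : 0ℚ ≤ x ⊎ x ≤ 0ℚ → x ≤ ∣ x ∣
  x≤∣x∣ (inj₁ 0≤x) = ≤-reflexive (sym (0≤p⇒∣p∣≡p 0≤x))
  x≤∣x∣ (inj₂ x≤0) = ≤-trans x≤0 (0≤∣p∣ x)

-- The two arguments are a point and an increment, so that functions, derivatives and remainders
-- share the same closure lemmas.
Bounded : (ℚ → ℚ → ℚ) → Set
Bounded f = ∃ λ K → ∀ {x h} → 0ℚ ≤ x → x ≤ 1ℚ → 0ℚ ≤ h → h ≤ 1ℚ → ∣ f x h ∣ ≤ K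

bounded-const : ∀ c → Bounded (λ _ _ → c)
bounded-const c = ∣ c ∣ , λ _ _ _ _ → ≤-refl

bounded-+ : ∀ {f g} → Bounded f → Bounded g → Bounded (λ x h → f x h + g x h)
bounded-+ {f} {g} (K , f≤K) (L , g≤L) = K + L , λ {x} {h} a b c d →
  ≤-trans (∣p+q∣≤∣p∣+∣q∣ (f x h) (g x h)) (+-mono-≤ (f≤K a b c d) (g≤L a b c d))

bounded-* : ∀ {f g} → Bounded f → Bounded g → Bounded (λ x h → f x h * g x h)
bounded-* {f} {g} (K , f≤K) (L , g≤L) = K * L , λ {x} {h} a b c d →
  subst (_≤ K * L) (sym (∣p*q∣≡∣p∣*∣q∣ (f x h) (g x h)))
    (*-mono-≤ (0≤∣p∣ (f x h)) (≤-trans (0≤∣p∣ (g x h)) (g≤L a b c d)) (f≤K a b c d) (g≤L a b c d))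

bounded-inc : Bounded (λ _ h → h)
bounded-inc = 1ℚ , λ _ _ 0≤h h≤1 → subst (_≤ 1ℚ) (sym (0≤p⇒∣p∣≡p 0≤h)) h≤1

bounded-id : Bounded (λ x _ → x)
bounded-id = 1ℚ , λ 0≤x x≤1 _ _ → subst (_≤ 1ℚ) (sym (0≤p⇒∣p∣≡p 0≤x)) x≤1

-- F has derivative F′ on [0, 1], in the strong sense that the remainder of the
-- first-order expansion is h² times a bounded function.
record Deriv (F F′ : ℚ → ℚ) : Set where
  field
    rem         : ℚ → ℚ → ℚ
    expansion   : ∀ x h → F (x + h) ≡ F x + h * F′ x + h * h * rem x h
    bounded     : Bounded (λ x _ → F x)
    bounded′    : Bounded (λ x _ → F′ x)
    bounded-rem : Bounded rem
open Deriv

deriv-cong : ∀ {F G F′ G′} → Deriv F F′ → (∀ x → F x ≡ G x) → (∀ x → F′ x ≡ G′ x) → Deriv G G′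
deriv-cong {F} {G} {F′} {G′} dF F≗G F′≗G′ = record
  { rem         = rem dF
  ; expansion   = λ x h → trans (sym (F≗G (x + h))) (trans (expansion dF x h)
                  (cong₂ (λ y y′ → y + h * y′ + h * h * rem dF x h) (F≗G x) (F′≗G′ x)))
  ; bounded     = bounded-cong F≗G (bounded dF)
  ; bounded′    = bounded-cong F′≗G′ (bounded′ dF)
  ; bounded-rem = bounded-rem dF
  }
  where
  bounded-cong : ∀ {f g : ℚ → ℚ} → (∀ x → f x ≡ g x) → Bounded (λ x _ → f x) → Bounded (λ x _ → g x)
  bounded-cong f≗g (K , f≤K) = K , λ {x} 0≤x x≤1 0≤h h≤1 →
    subst (λ y → ∣ y ∣ ≤ K) (f≗g x) (f≤K 0≤x x≤1 0≤h h≤1)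

deriv-const : ∀ c → Deriv (λ _ → c) (λ _ → 0ℚ)
deriv-const c = record
  { rem         = λ _ _ → 0ℚ
  ; expansion   = λ _ h → expand c h
  ; bounded     = bounded-const c
  ; bounded′    = bounded-const 0ℚ
  ; bounded-rem = bounded-const 0ℚ
  }
  where
  expand : ∀ c h → c ≡ c + h * 0ℚ + h * h * 0ℚ
  expand = solve-∀ ℚ-ring

deriv-id : Deriv (λ x → x) (λ _ → 1ℚ)
deriv-id = record
  { rem         = λ _ _ → 0ℚ
  ; expansion   = expand
  ; bounded     = bounded-id
  ; bounded′    = bounded-const 1ℚ
  ; bounded-rem = bounded-const 0ℚ
  }
  where
  expand : ∀ x h → x + h ≡ x + h * 1ℚ + h * h * 0ℚ
  expand = solve-∀ ℚ-ring

deriv-+ : ∀ {F F′ G G′} → Deriv F F′ → Deriv G G′ → Deriv (λ x → F x + G x) (λ x → F′ x + G′ x)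
deriv-+ {F} {F′} {G} {G′} dF dG = record
  { rem         = λ x h → rem dF x h + rem dG x h
  ; expansion   = λ x h → trans (cong₂ _+_ (expansion dF x h) (expansion dG x h))
                  (expand h (F x) (F′ x) (rem dF x h) (G x) (G′ x) (rem dG x h))
  ; bounded     = bounded-+ (bounded dF) (bounded dG)
  ; bounded′    = bounded-+ (bounded′ dF) (bounded′ dG)
  ; bounded-rem = bounded-+ (bounded-rem dF) (bounded-rem dG)
  }
  where
  expand : ∀ h f f′ r g g′ s → f + h * f′ + h * h * r + (g + h * g′ + h * h * s)
         ≡ f + g + h * (f′ + g′) + h * h * (r + s)
  expand = solve-∀ ℚ-ring

deriv-* : ∀ {F F′ G G′} → Deriv F F′ → Deriv G G′ →
  Deriv (λ x → F x * G x) (λ x → F′ x * G x + F x * G′ x)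
deriv-* {F} {F′} {G} {G′} dF dG = record
  -- The product of the two expansions beyond first order, divided by `h * h`; the terms that keep a
  -- factor h stay bounded because h ≤ 1.
  { rem         = λ x h → F′ x * G′ x + F x * rem dG x h + rem dF x h * G x
                  + h * (F′ x * rem dG x h + rem dF x h * (G′ x + h * rem dG x h))
  ; expansion   = λ x h → trans (cong₂ _*_ (expansion dF x h) (expansion dG x h))
                  (expand h (F x) (F′ x) (rem dF x h) (G x) (G′ x) (rem dG x h))
  ; bounded     = bounded-* (bounded dF) (bounded dG)
  ; bounded′    = bounded-+ (bounded-* (bounded′ dF) (bounded dG)) (bounded-* (bounded dF) (bounded′ dG))
  ; bounded-rem = bounded-+
      (bounded-+ (bounded-+ (bounded-* (bounded′ dF) (bounded′ dG)) (bounded-* (bounded dF) (bounded-rem dG)))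
        (bounded-* (bounded-rem dF) (bounded dG)))
      (bounded-* bounded-inc (bounded-+ (bounded-* (bounded′ dF) (bounded-rem dG))
        (bounded-* (bounded-rem dF) (bounded-+ (bounded′ dG) (bounded-* bounded-inc (bounded-rem dG))))))
  }
  where
  expand : ∀ h f f′ r g g′ s → (f + h * f′ + h * h * r) * (g + h * g′ + h * h * s)
         ≡ f * g + h * (f′ * g + f * g′)
           + h * h * (f′ * g′ + f * s + r * g + h * (f′ * s + r * (g′ + h * s)))
  expand = solve-∀ ℚ-ring

deriv-scale : ∀ {F F′} c → Deriv F F′ → Deriv (λ x → c * F x) (λ x → c * F′ x)
deriv-scale {F} {F′} c dF = deriv-cong (deriv-* (deriv-const c) dF) (λ _ → refl) (λ x → simplify c (F x) (F′ x))
  where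
  simplify : ∀ c f f′ → 0ℚ * f + c * f′ ≡ c * f′
  simplify = solve-∀ ℚ-ring

deriv-^ : ∀ {F F′} → Deriv F F′ → ∀ k →
  Deriv (λ x → F x ^ℚ suc k) (λ x → ℕ→ℚ (suc k) * (F x ^ℚ k) * F′ x)
deriv-^ {F} {F′} dF zero = deriv-cong (deriv-* dF (deriv-const 1ℚ)) (λ _ → refl) (λ x → simplify (F x) (F′ x))
  where
  simplify : ∀ f f′ → f′ * 1ℚ + f * 0ℚ ≡ 1ℚ * 1ℚ * f′
  simplify = solve-∀ ℚ-ring
deriv-^ {F} {F′} dF (suc k) = deriv-cong (deriv-* dF (deriv-^ dF k)) (λ _ → refl) (λ x → trans
    (simplify (F x) (F′ x) (F x ^ℚ k) (ℕ→ℚ (suc k)))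
    (cong (λ y → y * (F x ^ℚ suc k) * F′ x) (sym (ℕ→ℚ-suc (suc k)))))
  where
  simplify : ∀ f f′ g k → f′ * (f * g) + f * (k * g * f′) ≡ (1ℚ + k) * (f * g) * f′
  simplify = solve-∀ ℚ-ring

-- The mean value inequality by finite steps.

-- In a step from x to x + h the first-order term is at most 0 and the remainder adds at most
-- `h * h * K`; these errors accumulate linearly in the number of steps.
euler-steps : ∀ {F F′ K h} (dF : Deriv F F′) →
  (∀ {x h} → 0ℚ ≤ x → x ≤ 1ℚ → 0ℚ ≤ h → h ≤ 1ℚ → ∣ rem dF x h ∣ ≤ K) →
  (∀ x → 0ℚ ≤ x → x ≤ 1ℚ → F′ x ≤ 0ℚ) → 0ℚ ≤ h → h ≤ 1ℚ →
  ∀ i → ℕ→ℚ i * h ≤ 1ℚ → F (ℕ→ℚ i * h) ≤ F 0ℚ + ℕ→ℚ i * (h * h * K)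
euler-steps {F} {F′} {K} {h} dF rem≤K F′≤0 0≤h h≤1 = go
  where
  start : ∀ f c → f ≡ f + 0ℚ * c
  start = solve-∀ ℚ-ring
  next : ∀ k h → (1ℚ + k) * h ≡ k * h + h
  next = solve-∀ ℚ-ring
  collect : ∀ f c k h → f + k * c + h * 0ℚ + c ≡ f + (1ℚ + k) * c
  collect = solve-∀ ℚ-ring
  go : ∀ i → ℕ→ℚ i * h ≤ 1ℚ → F (ℕ→ℚ i * h) ≤ F 0ℚ + ℕ→ℚ i * (h * h * K)
  go zero    _      = ≤-reflexive (trans (cong F (*-zeroˡ h)) (start (F 0ℚ) (h * h * K)))
  go (suc i) i+1≤1/h = begin
    F (ℕ→ℚ (suc i) * h)                              ≡⟨ cong F step ⟩
    F (x + h)                                        ≡⟨ expansion dF x h ⟩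
    F x + h * F′ x + h * h * rem dF x h              ≤⟨ +-mono-≤ (+-mono-≤ (go i x≤1)
                                                          (*-monoˡ-≤-nonNeg h {{nonNegative 0≤h}} (F′≤0 x 0≤x x≤1)))
                                                          (*-monoˡ-≤-nonNeg (h * h) {{nonNegative (0≤* 0≤h 0≤h)}}
                                                            (∣x∣≤K⇒x≤K (rem≤K 0≤x x≤1 0≤h h≤1))) ⟩
    F 0ℚ + ℕ→ℚ i * (h * h * K) + h * 0ℚ + h * h * K  ≡⟨ collect (F 0ℚ) (h * h * K) (ℕ→ℚ i) h ⟩
    F 0ℚ + (1ℚ + ℕ→ℚ i) * (h * h * K)                ≡⟨ cong (λ y → F 0ℚ + y * (h * h * K)) (ℕ→ℚ-suc i) ⟨
    F 0ℚ + ℕ→ℚ (suc i) * (h * h * K)                 ∎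
    where
    open ≤-Reasoning
    x = ℕ→ℚ i * h
    step : ℕ→ℚ (suc i) * h ≡ x + h
    step = trans (cong (_* h) (ℕ→ℚ-suc i)) (next (ℕ→ℚ i) h)
    0≤x : 0ℚ ≤ x
    0≤x = 0≤* (0≤ℕ→ℚ i) 0≤h
    x≤1 : x ≤ 1ℚ
    x≤1 = ≤-trans (≤-by 0≤h refl) (subst (_≤ 1ℚ) step i+1≤1/h)

recip≤1 : ∀ k → recip k ≤ 1ℚ
recip≤1 k = ≤-by (0≤* (0≤ℕ→ℚ k) (<⇒≤ (0<recip k)))
  (trans (next (ℕ→ℚ k) (recip k)) (trans (cong (_* recip k) (sym (ℕ→ℚ-suc k))) (suc*recip k)))
  where
  next : ∀ k h → h + k * h ≡ (1ℚ + k) * h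
  next = solve-∀ ℚ-ring

-- N steps of length 1/N each increase F by at most K/N², so F 1 - F 0 ≤ K/N for every N.
F′≤0⇒F1≤F0 : ∀ {F F′} → Deriv F F′ → (∀ x → 0ℚ ≤ x → x ≤ 1ℚ → F′ x ≤ 0ℚ) → F 1ℚ ≤ F 0ℚ
F′≤0⇒F1≤F0 {F} dF F′≤0 = ≮⇒≥ λ F0<F1 →
  let K , rem≤K = bounded-rem dF
      d         = F 1ℚ - F 0ℚ
      0<d       = 0<y-x F0<F1
      instance
        d-pos : Positive d
        d-pos = positive 0<d
        d-nonZero : NonZero d
        d-nonZero = pos⇒nonZero d
      -- With N > K/d steps the total error K/N is smaller than the supposed increase d, a
      -- contradiction.
      k , K/d<N = archimedean (K * 1/ d)
      N         = ℕ→ℚ (suc k)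
      h         = recip k
      Nh≡1      = suc*recip k
      K<Nd : K < N * d
      K<Nd      = subst (_< N * d) (trans (*-assoc K (1/ d) d) (trans (cong (K *_) (*-inverseˡ d)) (*-identityʳ K)))
                    (*-monoˡ-<-pos d K/d<N)
      F1≤ : F 1ℚ ≤ F 0ℚ + h * K
      F1≤       = subst₂ _≤_ (cong F Nh≡1)
                    (trans (regroup (F 0ℚ) K N h) (trans (cong (λ y → F 0ℚ + y * (h * K)) Nh≡1) (drop (F 0ℚ) K h)))
                    (euler-steps dF rem≤K F′≤0 (<⇒≤ (0<recip k)) (recip≤1 k) (suc k) (≤-reflexive Nh≡1))
      hK<d : h * K < d
      hK<d      = subst (h * K <_) (trans (swap h N d) (trans (cong (_* d) Nh≡1) (*-identityˡ d)))
                    (*-monoʳ-<-pos h {{positive (0<recip k)}} K<Nd)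
  in <-irrefl refl (≤-<-trans F1≤ (<-≤-trans (+-monoʳ-< (F 0ℚ) hK<d) (≤-reflexive (cancel (F 0ℚ) (F 1ℚ)))))
  where
  regroup : ∀ f c n h → f + n * (h * h * c) ≡ f + n * h * (h * c)
  regroup = solve-∀ ℚ-ring
  drop : ∀ f c h → f + 1ℚ * (h * c) ≡ f + h * c
  drop = solve-∀ ℚ-ring
  swap : ∀ h n d → h * (n * d) ≡ n * h * d
  swap = solve-∀ ℚ-ring
  cancel : ∀ f g → f + (g - f) ≡ g
  cancel = solve-∀ ℚ-ring

-- The previous lemma applied to F - G. This stands in for monotonicity of the integral over [0, 1].
F′≤G′⇒ΔF≤ΔG : ∀ {F F′ G G′} → Deriv F F′ → Deriv G G′ →
  (∀ x → 0ℚ ≤ x → x ≤ 1ℚ → F′ x ≤ G′ x) → F 1ℚ - F 0ℚ ≤ G 1ℚ - G 0ℚ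
F′≤G′⇒ΔF≤ΔG {F} {F′} {G} {G′} dF dG F′≤G′ = ≤-by
  (0≤y-x (F′≤0⇒F1≤F0 (deriv-+ dF (deriv-scale (- 1ℚ) dG))
    (λ x 0≤x x≤1 → ≤-by (0≤y-x (F′≤G′ x 0≤x x≤1)) (sum≡0 (F′ x) (G′ x)))))
  (regroup (F 0ℚ) (F 1ℚ) (G 0ℚ) (G 1ℚ))
  where
  sum≡0 : ∀ f g → f + - 1ℚ * g + (g - f) ≡ 0ℚ
  sum≡0 = solve-∀ ℚ-ring
  regroup : ∀ f₀ f₁ g₀ g₁ → f₁ - f₀ + (f₀ + - 1ℚ * g₀ - (f₁ + - 1ℚ * g₁)) ≡ g₁ - g₀
  regroup = solve-∀ ℚ-ring

-- Powers and inequalities of Bernoulli type.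

0≤x² : ∀ x → 0ℚ ≤ x * x
0≤x² x with ≤-total 0ℚ x
... | inj₁ 0≤x = 0≤* 0≤x 0≤x
... | inj₂ x≤0 = nonNegative⁻¹ (x * x) {{nonPos*nonPos⇒nonPos x {{nonPositive x≤0}} x {{nonPositive x≤0}}}}

0≤^ : ∀ {x} → 0ℚ ≤ x → ∀ k → 0ℚ ≤ x ^ℚ k
0≤^ 0≤x zero    = 0≤1
0≤^ 0≤x (suc k) = 0≤* 0≤x (0≤^ 0≤x k)

0<^ : ∀ {x} → 0ℚ < x → ∀ k → 0ℚ < x ^ℚ k
0<^ 0<x zero    = positive⁻¹ 1ℚ
0<^ 0<x (suc k) = 0<* 0<x (0<^ 0<x k)

1^k≡1 : ∀ k → 1ℚ ^ℚ k ≡ 1ℚ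
1^k≡1 zero    = refl
1^k≡1 (suc k) = cong (1ℚ *_) (1^k≡1 k)

^-distrib-* : ∀ x y k → (x * y) ^ℚ k ≡ x ^ℚ k * y ^ℚ k
^-distrib-* x y zero    = refl
^-distrib-* x y (suc k) = trans (cong (x * y *_) (^-distrib-* x y k)) (interchange x y (x ^ℚ k) (y ^ℚ k))
  where
  interchange : ∀ x y u v → x * y * (u * v) ≡ x * u * (y * v)
  interchange = solve-∀ ℚ-ring

^-distribˡ-+ : ∀ x j k → x ^ℚ (j ℕ.+ k) ≡ x ^ℚ j * x ^ℚ k
^-distribˡ-+ x zero    k = sym (*-identityˡ (x ^ℚ k))
^-distribˡ-+ x (suc j) k = trans (cong (x *_) (^-distribˡ-+ x j k)) (sym (*-assoc x (x ^ℚ j) (x ^ℚ k)))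

-- Bernoulli's inequality for (1 + e/d)^k, multiplied by d^(k+1) to avoid the division. In the
-- induction the new gap is (d + e) times the old one plus k d^k e².
homogeneous-bernoulli : ∀ {d e} → 0ℚ ≤ d → 0ℚ ≤ d + e → ∀ k →
  d ^ℚ k * (d + ℕ→ℚ k * e) ≤ d * (d + e) ^ℚ k
homogeneous-bernoulli {d} {e} 0≤d 0≤d+e zero = ≤-reflexive (start d e)
  where
  start : ∀ d e → 1ℚ * (d + 0ℚ * e) ≡ d * 1ℚ
  start = solve-∀ ℚ-ring
homogeneous-bernoulli {d} {e} 0≤d 0≤d+e (suc k) = ≤-by
  (0≤+ (0≤* 0≤d+e (0≤y-x (homogeneous-bernoulli 0≤d 0≤d+e k)))
       (0≤* (0≤* (0≤^ 0≤d k) (0≤ℕ→ℚ k)) (0≤x² e)))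
  (trans (cong (λ n → d * d ^ℚ k * (d + n * e) + gap) (ℕ→ℚ-suc k))
         (next d e (ℕ→ℚ k) (d ^ℚ k) ((d + e) ^ℚ k)))
  where
  gap = (d + e) * (d * (d + e) ^ℚ k - d ^ℚ k * (d + ℕ→ℚ k * e)) + d ^ℚ k * ℕ→ℚ k * (e * e)
  next : ∀ d e k D P → d * D * (d + (1ℚ + k) * e) + ((d + e) * (d * P - D * (d + k * e)) + D * k * (e * e))
       ≡ d * ((d + e) * P)
  next = solve-∀ ℚ-ring

bernoulli : ∀ {x} → 0ℚ ≤ x → ∀ k → 1ℚ + ℕ→ℚ k * (x - 1ℚ) ≤ x ^ℚ k
bernoulli {x} 0≤x k = subst₂ _≤_
  (trans (cong (_* (1ℚ + ℕ→ℚ k * (x - 1ℚ))) (1^k≡1 k)) (*-identityˡ _))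
  (trans (*-identityˡ _) (cong (_^ℚ k) (1+[x-1] x)))
  (homogeneous-bernoulli 0≤1 (subst (0ℚ ≤_) (sym (1+[x-1] x)) 0≤x) k)
  where
  1+[x-1] : ∀ x → 1ℚ + (x - 1ℚ) ≡ x
  1+[x-1] = solve-∀ ℚ-ring

-- Induction on k: the bound for k times 1 + z falls short of the bound for k + 1 by z²(1 + k(1 -
-- kz)), which is nonnegative as long as kz ≤ 1.
[1+z]^k≤1+kz+[kz]² : ∀ {z} → 0ℚ ≤ z → ∀ k → ℕ→ℚ k * z ≤ 1ℚ →
  (1ℚ + z) ^ℚ k ≤ 1ℚ + ℕ→ℚ k * z + ℕ→ℚ k * z * (ℕ→ℚ k * z)
[1+z]^k≤1+kz+[kz]² {z} 0≤z zero    _ = ≤-reflexive (start z)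
  where
  start : ∀ z → 1ℚ ≡ 1ℚ + 0ℚ * z + 0ℚ * z * (0ℚ * z)
  start = solve-∀ ℚ-ring
[1+z]^k≤1+kz+[kz]² {z} 0≤z (suc k) [1+k]z≤1 = ≤-by
  (0≤+ (0≤* (0≤+ 0≤1 0≤z) (0≤y-x ([1+z]^k≤1+kz+[kz]² 0≤z k kz≤1)))
       (0≤* (0≤x² z) (0≤+ 0≤1 (0≤* (0≤ℕ→ℚ k) (0≤y-x kz≤1)))))
  (trans (next z (ℕ→ℚ k) ((1ℚ + z) ^ℚ k))
         (cong (λ n → 1ℚ + n * z + n * z * (n * z)) (sym (ℕ→ℚ-suc k))))
  where
  split : ∀ k z → k * z + z ≡ (1ℚ + k) * z
  split = solve-∀ ℚ-ring
  kz≤1 : ℕ→ℚ k * z ≤ 1ℚ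
  kz≤1 = ≤-trans (≤-by 0≤z (trans (split (ℕ→ℚ k) z) (cong (_* z) (sym (ℕ→ℚ-suc k))))) [1+k]z≤1
  next : ∀ z k P → (1ℚ + z) * P + ((1ℚ + z) * (1ℚ + k * z + k * z * (k * z) - P) + z * z * (1ℚ + k * (1ℚ - k * z)))
       ≡ 1ℚ + (1ℚ + k) * z + (1ℚ + k) * z * ((1ℚ + k) * z)
  next = solve-∀ ℚ-ring

-- Several ring identities below hold only modulo relations p ≡ 1 such as b · (1/b) ≡ 1;
-- r and s are the cofactors of the relations.
≡-modulo : ∀ {x y p q} r s → p ≡ 1ℚ → q ≡ 1ℚ → x ≡ y + r * (p - 1ℚ) + s * (q - 1ℚ) → x ≡ y
≡-modulo {y = y} r s refl refl x≡ = trans x≡ (vanish y r s)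
  where
  vanish : ∀ y r s → y + r * (1ℚ - 1ℚ) + s * (1ℚ - 1ℚ) ≡ y
  vanish = solve-∀ ℚ-ring

-- The density and its monotonicity in m.

0≤1-recip*u : ∀ k {u} → u ≤ 1ℚ → 0ℚ ≤ 1ℚ - recip k * u
0≤1-recip*u k {u} u≤1 = subst (0ℚ ≤_) (regroup (recip k) u)
  (0≤+ (0≤y-x (recip≤1 k)) (0≤* (<⇒≤ (0<recip k)) (0≤y-x u≤1)))
  where
  regroup : ∀ r u → 1ℚ - r + r * (1ℚ - u) ≡ 1ℚ - r * u
  regroup = solve-∀ ℚ-ring

-- Let d and d + e be the two bases. Homogeneous Bernoulli bounds `d * (d + e) ^ℚ m` below by
-- `d ^ℚ m * (d + M * e)`, so after multiplying the claim by d > 0 it suffices that d² ≤ d + me.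
[1-u/[m+2]]^[m+1]≤[1-u/[m+1]]^m : ∀ m {u} → 0ℚ ≤ u → u ≤ 1ℚ →
  (1ℚ - recip (suc m) * u) ^ℚ suc m ≤ (1ℚ - recip m * u) ^ℚ m
[1-u/[m+2]]^[m+1]≤[1-u/[m+1]]^m m {u} 0≤u u≤1 = *-cancelˡ-≤-pos d {{positive 0<d}} (begin
  d * (d * d ^ℚ m)           ≤⟨ ≤-by (0≤* (0≤^ 0≤d m) 0≤gap) (regroup d (d ^ℚ m) (M * e)) ⟩
  d ^ℚ m * (d + M * e)       ≤⟨ homogeneous-bernoulli 0≤d (subst (0ℚ ≤_) (sym d+e≡) (0≤1-recip*u m u≤1)) m ⟩
  d * (d + e) ^ℚ m           ≡⟨ cong (λ x → d * x ^ℚ m) d+e≡ ⟩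
  d * (1ℚ - γ * u) ^ℚ m      ∎)
  where
  open ≤-Reasoning
  M = ℕ→ℚ m
  γ = recip m
  ρ = recip (suc m)
  d = 1ℚ - ρ * u
  e = ρ * u - γ * u
  0≤γ = <⇒≤ (0<recip m)
  0≤ρ = <⇒≤ (0<recip (suc m))
  0≤d = 0≤1-recip*u (suc m) u≤1
  γ-eq : (1ℚ + M) * γ ≡ 1ℚ
  γ-eq = trans (cong (_* γ) (sym (ℕ→ℚ-suc m))) (suc*recip m)
  ρ-eq : (1ℚ + (1ℚ + M)) * ρ ≡ 1ℚ
  ρ-eq = trans (cong (_* ρ) (sym (trans (ℕ→ℚ-suc (suc m)) (cong (1ℚ +_) (ℕ→ℚ-suc m))))) (suc*recip (suc m))
  d+e≡ : d + e ≡ 1ℚ - γ * u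
  d+e≡ = telescope (ρ * u) (γ * u)
    where
    telescope : ∀ x y → 1ℚ - x + (x - y) ≡ 1ℚ - y
    telescope = solve-∀ ℚ-ring
  0<d : 0ℚ < d
  0<d = <-≤-trans (0<* (<-≤-trans (positive⁻¹ 1ℚ) (≤-by (0≤ℕ→ℚ m) refl)) (0<recip (suc m)))
    (≤-by (0≤* 0≤ρ (0≤y-x u≤1)) (sym (≡-modulo 0ℚ (- 1ℚ) γ-eq ρ-eq (identity ρ γ M u))))
    where
    identity : ∀ ρ γ M u → 1ℚ - ρ * u
      ≡ (1ℚ + M) * ρ + ρ * (1ℚ - u) + 0ℚ * ((1ℚ + M) * γ - 1ℚ) + - 1ℚ * ((1ℚ + (1ℚ + M)) * ρ - 1ℚ)
    identity = solve-∀ ℚ-ring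
  -- From γ - ρ = ργ the gap equals ρu(γ - ρu) = ρu(ργ + ρ(1 - u)).
  0≤gap : 0ℚ ≤ d + M * e - d * d
  0≤gap = subst (0ℚ ≤_)
    (sym (≡-modulo (- u + u * ρ + ρ * u * ρ) (u - u * γ - ρ * u * γ) γ-eq ρ-eq (identity ρ γ M u)))
    (0≤* (0≤* 0≤ρ 0≤u) (0≤+ (0≤* 0≤ρ 0≤γ) (0≤* 0≤ρ (0≤y-x u≤1))))
    where
    identity : ∀ ρ γ M u → 1ℚ - ρ * u + M * (ρ * u - γ * u) - (1ℚ - ρ * u) * (1ℚ - ρ * u)
      ≡ ρ * u * (ρ * γ + ρ * (1ℚ - u)) + (- u + u * ρ + ρ * u * ρ) * ((1ℚ + M) * γ - 1ℚ)
        + (u - u * γ - ρ * u * γ) * ((1ℚ + (1ℚ + M)) * ρ - 1ℚ)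
    identity = solve-∀ ℚ-ring
  regroup : ∀ d D x → d * (d * D) + D * (d + x - d * d) ≡ D * (d + x)
  regroup = solve-∀ ℚ-ring

-- The function f of the header, for b = b′ + 1.
density : ℕ → ℕ → ℚ → ℚ
density b′ m u = (1ℚ + recip b′ * u) ^ℚ suc b′ * (1ℚ - recip m * u) ^ℚ m

0≤1+recip*u : ∀ k {u} → 0ℚ ≤ u → 0ℚ ≤ 1ℚ + recip k * u
0≤1+recip*u k 0≤u = 0≤+ 0≤1 (0≤* (<⇒≤ (0<recip k)) 0≤u)

-- Only the second factor depends on m. This extends the two borderline estimates below to all m on
-- the respective side.
density-antitone : ∀ b′ {m m′} → m ℕ.≤ m′ → ∀ {u} → 0ℚ ≤ u → u ≤ 1ℚ → density b′ m′ u ≤ density b′ m u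
density-antitone b′ m≤m′ {u} 0≤u u≤1 =
  *-monoˡ-≤-nonNeg ((1ℚ + recip b′ * u) ^ℚ suc b′) {{nonNegative (0≤^ (0≤1+recip*u b′ 0≤u) (suc b′))}} (go (ℕ.≤⇒≤′ m≤m′))
  where
  go : ∀ {m m′} → m ℕ.≤′ m′ → (1ℚ - recip m′ * u) ^ℚ m′ ≤ (1ℚ - recip m * u) ^ℚ m
  go (ℕ.≤′-reflexive refl) = ≤-refl
  go (ℕ.≤′-step {m′} m≤m′) = ≤-trans ([1-u/[m+2]]^[m+1]≤[1-u/[m+1]]^m m′ 0≤u u≤1) (go m≤m′)

-- Polynomial bounds for the density at m = 2b and m = 2b + 1.

quartic : (c₀ c₁ c₂ c₃ c₄ : ℚ) → ℚ → ℚ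
quartic c₀ c₁ c₂ c₃ c₄ u = c₀ + u * (c₁ + u * (c₂ + u * (c₃ + u * c₄)))

-- At ρ = 1/(2b + 1) and κ = 1/(2b + 2) these are 1 + bz and (1 - κu)(1 + bz) + W²,
-- where W = κu(2 - 3u/2) majorises bz.
lower upper : ℚ → ℚ → ℚ
lower ρ = quartic 1ℚ ρ (- (½ * (ρ * (pos 3 / 1 + ρ)))) (ρ * ρ) 0ℚ
upper κ = quartic 1ℚ κ (κ * κ - pos 3 / 2 * κ) (κ * κ * (κ - pos 7 / 2)) (κ * κ * (pos 9 / 4 - κ))

-- For m = 2b the density is the b-th power of `w * (v * v)`, to which Bernoulli applies directly; b
-- then disappears through bα = 1 and (2b + 1)ρ = 1.
lower≤density : ∀ b′ → let b = suc b′ in ∀ {u} → 0ℚ ≤ u → u ≤ 1ℚ →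
  lower (recip (b ℕ.+ b)) u ≤ density b′ (b ℕ.+ b) u
lower≤density b′ {u} 0≤u u≤1 = begin
  lower ρ u                        ≡⟨ ≡-modulo (u * (v * v)) (½ * (ρ * (u * u)) - u) α-eq ρ-eq (identity α ρ B u) ⟨
  1ℚ + B * (w * (v * v) - 1ℚ)      ≤⟨ bernoulli (0≤* (0≤1+recip*u b′ 0≤u) (0≤x² v)) b ⟩
  (w * (v * v)) ^ℚ b               ≡⟨ ^-distrib-* w (v * v) b ⟩
  w ^ℚ b * (v * v) ^ℚ b            ≡⟨ cong (w ^ℚ b *_) (trans (^-distrib-* v v b) (sym (^-distribˡ-+ v b b))) ⟩
  w ^ℚ b * v ^ℚ (b ℕ.+ b)          ∎
  where
  open ≤-Reasoning
  b = suc b′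
  B = ℕ→ℚ b
  α = recip b′
  ρ = recip (b ℕ.+ b)
  w = 1ℚ + α * u
  v = 1ℚ - ρ * u
  α-eq : B * α ≡ 1ℚ
  α-eq = suc*recip b′
  ρ-eq : (1ℚ + (B + B)) * ρ ≡ 1ℚ
  ρ-eq = trans (cong (_* ρ) (sym (trans (ℕ→ℚ-suc (b ℕ.+ b)) (cong (1ℚ +_) (ℕ→ℚ-+ b b))))) (suc*recip (b ℕ.+ b))
  identity : ∀ α ρ B u → 1ℚ + B * ((1ℚ + α * u) * ((1ℚ - ρ * u) * (1ℚ - ρ * u)) - 1ℚ)
    ≡ 1ℚ + u * (ρ + u * (- (½ * (ρ * (pos 3 / 1 + ρ))) + u * (ρ * ρ + u * 0ℚ)))
      + u * ((1ℚ - ρ * u) * (1ℚ - ρ * u)) * (B * α - 1ℚ)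
      + (½ * (ρ * (u * u)) - u) * ((1ℚ + (B + B)) * ρ - 1ℚ)
  identity = solve-∀ ℚ-ring

-- For m = 2b + 1 one factor v is left over beside the b-th power of `w * (v * v)`, whose base is 1
-- + Z/b; the quadratic upper bound needs 0 ≤ Z ≤ 1.
density≤upper : ∀ b′ → let b = suc b′ in ∀ {u} → 0ℚ ≤ u → u ≤ 1ℚ →
  density b′ (suc (b ℕ.+ b)) u ≤ upper (recip (suc (b ℕ.+ b))) u
density≤upper b′ {u} 0≤u u≤1 = begin
  w ^ℚ b * (v * v ^ℚ (b ℕ.+ b))          ≡⟨ cong (λ x → w ^ℚ b * (v * x))
                                               (trans (^-distribˡ-+ v b b) (sym (^-distrib-* v v b))) ⟩
  w ^ℚ b * (v * (v * v) ^ℚ b)            ≡⟨ swap (w ^ℚ b) v ((v * v) ^ℚ b) ⟩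
  v * (w ^ℚ b * (v * v) ^ℚ b)            ≡⟨ cong (v *_) (^-distrib-* w (v * v) b) ⟨
  v * (w * (v * v)) ^ℚ b                 ≡⟨ cong (λ x → v * x ^ℚ b) base ⟩
  v * (1ℚ + α * Z) ^ℚ b                  ≤⟨ *-monoˡ-≤-nonNeg v {{nonNegative 0≤v}}
                                              ([1+z]^k≤1+kz+[kz]² (0≤* (<⇒≤ (0<recip b′)) 0≤Z) b
                                                (subst (_≤ 1ℚ) (sym BαZ≡Z) (≤-trans Z≤W W≤1))) ⟩
  v * (1ℚ + B * (α * Z) + B * (α * Z) * (B * (α * Z)))
                                         ≡⟨ cong (λ x → v * (1ℚ + x + x * x)) BαZ≡Z ⟩
  -- Bounding v Z² by W² brings the degree in u down from 7 to 4; the loss is W² - Z² plus κu Z².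
  v * (1ℚ + Z + Z * Z)                   ≤⟨ ≤-by (0≤+ (0≤y-x (*-mono-≤ 0≤Z (≤-trans 0≤Z Z≤W) Z≤W Z≤W))
                                                       (0≤* (0≤* 0≤κ 0≤u) (0≤x² Z)))
                                              (regroup (κ * u) Z W) ⟩
  v * (1ℚ + Z) + W * W                   ≡⟨ expand κ u ⟩
  upper κ u                              ∎
  where
  open ≤-Reasoning
  b = suc b′
  B = ℕ→ℚ b
  α = recip b′
  κ = recip (suc (b ℕ.+ b))
  w = 1ℚ + α * u
  v = 1ℚ - κ * u
  -- Z is b(wv² - 1) with b eliminated by (2b + 2)κ = 1, and W = Z + κ²u²(1 - u).
  Z = u * (pos 2 / 1 * κ - κ * (pos 3 / 2 + κ) * u + κ * κ * (u * u))
  W = κ * u * (pos 2 / 1 - pos 3 / 2 * u)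
  0≤κ = <⇒≤ (0<recip (suc (b ℕ.+ b)))
  0≤1-u = 0≤y-x u≤1
  0≤v = 0≤1-recip*u (suc (b ℕ.+ b)) u≤1
  α-eq : B * α ≡ 1ℚ
  α-eq = suc*recip b′
  κ-eq : (1ℚ + (1ℚ + (B + B))) * κ ≡ 1ℚ
  κ-eq = trans (cong (_* κ) (sym (trans (ℕ→ℚ-suc (suc (b ℕ.+ b)))
    (cong (1ℚ +_) (trans (ℕ→ℚ-suc (b ℕ.+ b)) (cong (1ℚ +_) (ℕ→ℚ-+ b b))))))) (suc*recip (suc (b ℕ.+ b)))
  swap : ∀ x y z → x * (y * z) ≡ y * (x * z)
  swap = solve-∀ ℚ-ring
  base : w * (v * v) ≡ 1ℚ + α * Z
  base = ≡-modulo (1ℚ - v * v) (α * (½ * (κ * (u * u)) - u)) α-eq κ-eq (identity α κ B u)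
    where
    identity : ∀ α κ B u → (1ℚ + α * u) * ((1ℚ - κ * u) * (1ℚ - κ * u))
      ≡ 1ℚ + α * (u * (pos 2 / 1 * κ - κ * (pos 3 / 2 + κ) * u + κ * κ * (u * u)))
        + (1ℚ - (1ℚ - κ * u) * (1ℚ - κ * u)) * (B * α - 1ℚ)
        + α * (½ * (κ * (u * u)) - u) * ((1ℚ + (1ℚ + (B + B))) * κ - 1ℚ)
    identity = solve-∀ ℚ-ring
  BαZ≡Z : B * (α * Z) ≡ Z
  BαZ≡Z = trans (sym (*-assoc B α Z)) (trans (cong (_* Z) α-eq) (*-identityˡ Z))
  0≤Z : 0ℚ ≤ Z
  0≤Z = subst (0ℚ ≤_) (sym (≡-modulo 0ℚ (- (½ * (κ * u))) α-eq κ-eq (identity α κ B u)))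
    -- The value of Z/u at u = 1 is κ/2 = κ(bκ) + κ², and the decomposition expands around that
    -- point.
    (0≤* 0≤u (0≤+ (0≤+ (0≤* 0≤κ (0≤* (0≤ℕ→ℚ b) 0≤κ))
                       (0≤* (0≤* 0≤κ (0≤+ (nonNegative⁻¹ (pos 3 / 2)) 0≤κ)) 0≤1-u))
                  (0≤x² (κ * u))))
    where
    identity : ∀ α κ B u → u * (pos 2 / 1 * κ - κ * (pos 3 / 2 + κ) * u + κ * κ * (u * u))
      ≡ u * (κ * (B * κ) + κ * (pos 3 / 2 + κ) * (1ℚ - u) + κ * u * (κ * u))
        + 0ℚ * (B * α - 1ℚ) + - (½ * (κ * u)) * ((1ℚ + (1ℚ + (B + B))) * κ - 1ℚ)
    identity = solve-∀ ℚ-ring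
  Z≤W : Z ≤ W
  Z≤W = ≤-by (0≤* (0≤x² (κ * u)) 0≤1-u) (identity κ u)
    where
    identity : ∀ κ u → u * (pos 2 / 1 * κ - κ * (pos 3 / 2 + κ) * u + κ * κ * (u * u)) + κ * u * (κ * u) * (1ℚ - u)
      ≡ κ * u * (pos 2 / 1 - pos 3 / 2 * u)
    identity = solve-∀ ℚ-ring
  W≤1 : W ≤ 1ℚ
  W≤1 = ≤-by
    (0≤+ (0≤+ (0≤* (0≤+ (0≤ℕ→ℚ b) (0≤ℕ→ℚ b)) 0≤κ) (0≤* (0≤* (nonNegative⁻¹ (pos 2 / 1)) 0≤κ) 0≤1-u))
         (0≤* (nonNegative⁻¹ (pos 3 / 2)) (0≤* 0≤κ (0≤x² u))))
    (≡-modulo 0ℚ 1ℚ α-eq κ-eq (identity α κ B u))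
    where
    identity : ∀ α κ B u → κ * u * (pos 2 / 1 - pos 3 / 2 * u)
      + ((B + B) * κ + pos 2 / 1 * κ * (1ℚ - u) + pos 3 / 2 * (κ * (u * u)))
      ≡ 1ℚ + 0ℚ * (B * α - 1ℚ) + 1ℚ * ((1ℚ + (1ℚ + (B + B))) * κ - 1ℚ)
    identity = solve-∀ ℚ-ring
  regroup : ∀ x Z W → (1ℚ - x) * (1ℚ + Z + Z * Z) + (W * W - Z * Z + x * (Z * Z)) ≡ (1ℚ - x) * (1ℚ + Z) + W * W
  regroup = solve-∀ ℚ-ring
  expand : ∀ κ u → (1ℚ - κ * u) * (1ℚ + u * (pos 2 / 1 * κ - κ * (pos 3 / 2 + κ) * u + κ * κ * (u * u)))
      + κ * u * (pos 2 / 1 - pos 3 / 2 * u) * (κ * u * (pos 2 / 1 - pos 3 / 2 * u))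
    ≡ 1ℚ + u * (κ + u * (κ * κ - pos 3 / 2 * κ + u * (κ * κ * (κ - pos 7 / 2) + u * (κ * κ * (pos 9 / 4 - κ)))))
  expand = solve-∀ ℚ-ring

-- Binomial coefficients.

-- The ratio of neighbouring coefficients in subtraction-free form, hence valid also for k > n;
-- induction on n by Pascal's rule.
[k+1]*nC[k+1]+k*nCk≡n*nCk : ∀ n k → suc k ℕ.* (n C suc k) ℕ.+ k ℕ.* (n C k) ≡ n ℕ.* (n C k)
[k+1]*nC[k+1]+k*nCk≡n*nCk n       zero    = trans (ℕ.+-identityʳ _) (trans (ℕ.+-identityʳ _) (trans (nC1≡n n) (sym (ℕ.*-identityʳ n))))
[k+1]*nC[k+1]+k*nCk≡n*nCk zero    (suc k) = cong₂ ℕ._+_ (ℕ.*-zeroʳ (suc (suc k))) (ℕ.*-zeroʳ (suc k))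
[k+1]*nC[k+1]+k*nCk≡n*nCk (suc n) (suc k) = begin
  suc (suc k) ℕ.* (suc n C suc (suc k)) ℕ.+ suc k ℕ.* (suc n C suc k)
    ≡⟨ cong₂ (λ x y → suc (suc k) ℕ.* x ℕ.+ suc k ℕ.* y)
         (nCk+nC[k+1]≡[n+1]C[k+1] n (suc k)) (nCk+nC[k+1]≡[n+1]C[k+1] n k) ⟨
  suc (suc k) ℕ.* (b ℕ.+ c) ℕ.+ suc k ℕ.* (a ℕ.+ b)
    ≡⟨ regroup k a b c ⟩
  suc (suc k) ℕ.* c ℕ.+ suc k ℕ.* b ℕ.+ (suc k ℕ.* b ℕ.+ k ℕ.* a) ℕ.+ (a ℕ.+ b)
    ≡⟨ cong₂ (λ x y → x ℕ.+ y ℕ.+ (a ℕ.+ b)) ([k+1]*nC[k+1]+k*nCk≡n*nCk n (suc k)) ([k+1]*nC[k+1]+k*nCk≡n*nCk n k) ⟩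
  n ℕ.* b ℕ.+ n ℕ.* a ℕ.+ (a ℕ.+ b)
    ≡⟨ collect n a b ⟩
  suc n ℕ.* (a ℕ.+ b)
    ≡⟨ cong (suc n ℕ.*_) (nCk+nC[k+1]≡[n+1]C[k+1] n k) ⟩
  suc n ℕ.* (suc n C suc k) ∎
  where
  open ≡-Reasoning
  a = n C k
  b = n C suc k
  c = n C suc (suc k)
  regroup : ∀ k a b c → suc (suc k) ℕ.* (b ℕ.+ c) ℕ.+ suc k ℕ.* (a ℕ.+ b)
    ≡ suc (suc k) ℕ.* c ℕ.+ suc k ℕ.* b ℕ.+ (suc k ℕ.* b ℕ.+ k ℕ.* a) ℕ.+ (a ℕ.+ b)
  regroup = ℕ-Solver.solve-∀
  collect : ∀ n a b → n ℕ.* b ℕ.+ n ℕ.* a ℕ.+ (a ℕ.+ b) ≡ suc n ℕ.* (a ℕ.+ b)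
  collect = ℕ-Solver.solve-∀

[k+1]*nC[k+1]≡[n-k]*nCk : ∀ k l → let n = k ℕ.+ l in suc k ℕ.* (n C suc k) ≡ l ℕ.* (n C k)
[k+1]*nC[k+1]≡[n-k]*nCk k l = ℕ.+-cancelʳ-≡ (k ℕ.* (n C k)) _ _ (begin
  suc k ℕ.* (n C suc k) ℕ.+ k ℕ.* (n C k)  ≡⟨ [k+1]*nC[k+1]+k*nCk≡n*nCk n k ⟩
  n ℕ.* (n C k)                            ≡⟨ ℕ.*-distribʳ-+ (n C k) k l ⟩
  k ℕ.* (n C k) ℕ.+ l ℕ.* (n C k)          ≡⟨ ℕ.+-comm (k ℕ.* (n C k)) _ ⟩
  l ℕ.* (n C k) ℕ.+ k ℕ.* (n C k)          ∎)
  where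
  open ≡-Reasoning
  n = k ℕ.+ l

0<nCk : ∀ k l → 0 ℕ.< (k ℕ.+ l) C k
0<nCk zero    l = ℕ.s≤s ℕ.z≤n
0<nCk (suc k) l = subst (0 ℕ.<_) (nCk+nC[k+1]≡[n+1]C[k+1] (k ℕ.+ l) k) (ℕ.<-≤-trans (0<nCk k l) (ℕ.m≤m+n _ _))

-- The derivative of the binomial distribution function along an affine success probability.

module _ {Q : ℚ → ℚ} {ν : ℚ} (dQ : Deriv Q (λ _ → ν)) where

  deriv-1-Q : Deriv (λ u → 1ℚ - Q u) (λ _ → - ν)
  deriv-1-Q = deriv-cong (deriv-+ (deriv-const 1ℚ) (deriv-scale (- 1ℚ) dQ)) (λ u → negate 1ℚ (Q u)) (λ _ → negate₀ ν)
    where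
    negate : ∀ x y → x + - 1ℚ * y ≡ x - y
    negate = solve-∀ ℚ-ring
    negate₀ : ∀ y → 0ℚ + - 1ℚ * y ≡ - y
    negate₀ = solve-∀ ℚ-ring

  private
    binomPmf-exponent : ∀ j l {F′} → let n = j ℕ.+ l in
      Deriv (λ u → ℕ→ℚ (n C j) * (Q u ^ℚ j * (1ℚ - Q u) ^ℚ l)) F′ → Deriv (λ u → binomPmf n (Q u) j) F′
    binomPmf-exponent j l {F′} =
      subst (λ e → Deriv (λ u → ℕ→ℚ ((j ℕ.+ l) C j) * (Q u ^ℚ j * (1ℚ - Q u) ^ℚ e)) F′) (sym (ℕ.m+n∸m≡n j l))

  -- The derivatives of successive terms telescope, leaving only the top one.
  deriv-cdf : ∀ j l {n} → j ℕ.+ suc l ≡ n → Deriv (λ u → sumBelow (suc j) (binomPmf n (Q u)))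
    (λ u → - (ℕ→ℚ (suc l) * ℕ→ℚ (n C j) * (Q u ^ℚ j * (1ℚ - Q u) ^ℚ l) * ν))
  deriv-cdf zero l refl = deriv-cong
    (deriv-+ (deriv-const 0ℚ) (deriv-scale (ℕ→ℚ (suc l C 0)) (deriv-* (deriv-const 1ℚ) (deriv-^ deriv-1-Q l))))
    (λ _ → refl)
    (λ u → simplify (ℕ→ℚ (suc l)) (ℕ→ℚ (suc l C 0)) (1ℚ - Q u) ((1ℚ - Q u) ^ℚ l) ν)
    where
    simplify : ∀ L c r R ν → 0ℚ + c * (0ℚ * (r * R) + 1ℚ * (L * R * - ν)) ≡ - (L * c * (1ℚ * R) * ν)
    simplify = solve-∀ ℚ-ring
  deriv-cdf (suc j) l refl = deriv-cong
    (deriv-+ (deriv-cdf j (suc l) (ℕ.+-suc j (suc l)))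
             (binomPmf-exponent (suc j) (suc l)
               (deriv-scale (ℕ→ℚ (n C suc j)) (deriv-* (deriv-^ dQ j) (deriv-^ deriv-1-Q l)))))
    (λ _ → refl)
    (λ u → let q = Q u; P = q ^ℚ j; r = 1ℚ - q; R = r ^ℚ l in trans
      (cong (λ x → - (x * (P * (r * R)) * ν) + ℕ→ℚ (n C suc j) * (ℕ→ℚ (suc j) * P * ν * (r * R) + q * P * (ℕ→ℚ (suc l) * R * - ν)))
        coefficients)
      (cancel (ℕ→ℚ (suc j)) (ℕ→ℚ (suc l)) (ℕ→ℚ (n C suc j)) q P r R ν))
    where
    n = suc j ℕ.+ suc l
    -- As n - j = l + 2, this is (n - j) C(n, j) = (j + 1) C(n, j + 1): what is left from term j
    -- cancels the part of the next term where `Q u ^ℚ suc j` is differentiated.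
    coefficients : ℕ→ℚ (suc (suc l)) * ℕ→ℚ (n C j) ≡ ℕ→ℚ (suc j) * ℕ→ℚ (n C suc j)
    coefficients = begin
      ℕ→ℚ (suc (suc l)) * ℕ→ℚ (n C j)  ≡⟨ ℕ→ℚ-* (suc (suc l)) (n C j) ⟨
      ℕ→ℚ (suc (suc l) ℕ.* (n C j))    ≡⟨ cong ℕ→ℚ (subst (λ n → suc (suc l) ℕ.* (n C j) ≡ suc j ℕ.* (n C suc j))
                                            (ℕ.+-suc j (suc l)) (sym ([k+1]*nC[k+1]≡[n-k]*nCk j (suc (suc l))))) ⟩
      ℕ→ℚ (suc j ℕ.* (n C suc j))      ≡⟨ ℕ→ℚ-* (suc j) (n C suc j) ⟩
      ℕ→ℚ (suc j) * ℕ→ℚ (n C suc j)    ∎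
      where open ≡-Reasoning
    cancel : ∀ J L c q P r R ν →
      - (J * c * (P * (r * R)) * ν) + c * (J * P * ν * (r * R) + q * P * (L * R * - ν))
      ≡ - (L * c * (q * P * R) * ν)
    cancel = solve-∀ ℚ-ring

-- Integrals of quartics over [0, 1].

antiderivative : (c₀ c₁ c₂ c₃ c₄ : ℚ) → ℚ → ℚ
antiderivative c₀ c₁ c₂ c₃ c₄ u =
  u * (c₀ + u * (½ * c₁ + u * (pos 1 / 3 * c₂ + u * (pos 1 / 4 * c₃ + u * (pos 1 / 5 * c₄)))))

deriv-antiderivative : ∀ c₀ c₁ c₂ c₃ c₄ → Deriv (antiderivative c₀ c₁ c₂ c₃ c₄) (quartic c₀ c₁ c₂ c₃ c₄)
deriv-antiderivative c₀ c₁ c₂ c₃ c₄ = deriv-cong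
  (deriv-* deriv-id (horner c₀ (horner (½ * c₁) (horner (pos 1 / 3 * c₂) (horner (pos 1 / 4 * c₃)
    (deriv-const (pos 1 / 5 * c₄)))))))
  (λ _ → refl) (λ u → simplify c₀ c₁ c₂ c₃ c₄ u)
  where
  horner : ∀ {F F′} c → Deriv F F′ → Deriv (λ u → c + u * F u) (λ u → 0ℚ + (1ℚ * F u + u * F′ u))
  horner c dF = deriv-+ (deriv-const c) (deriv-* deriv-id dF)
  simplify : ∀ a b c d e u →
    1ℚ * (a + u * (½ * b + u * (pos 1 / 3 * c + u * (pos 1 / 4 * d + u * (pos 1 / 5 * e)))))
    + u * (0ℚ + (1ℚ * (½ * b + u * (pos 1 / 3 * c + u * (pos 1 / 4 * d + u * (pos 1 / 5 * e))))
    + u * (0ℚ + (1ℚ * (pos 1 / 3 * c + u * (pos 1 / 4 * d + u * (pos 1 / 5 * e)))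
    + u * (0ℚ + (1ℚ * (pos 1 / 4 * d + u * (pos 1 / 5 * e))
    + u * (0ℚ + (1ℚ * (pos 1 / 5 * e) + u * 0ℚ))))))))
    ≡ a + u * (b + u * (c + u * (d + u * e)))
  simplify = solve-∀ ℚ-ring

Δ-antiderivative : ∀ K c₀ c₁ c₂ c₃ c₄ →
  K * antiderivative c₀ c₁ c₂ c₃ c₄ 1ℚ - K * antiderivative c₀ c₁ c₂ c₃ c₄ 0ℚ
  ≡ K * (c₀ + ½ * c₁ + pos 1 / 3 * c₂ + pos 1 / 4 * c₃ + pos 1 / 5 * c₄)
Δ-antiderivative = evaluate
  where
  evaluate : ∀ K a b c d e →
    K * (1ℚ * (a + 1ℚ * (½ * b + 1ℚ * (pos 1 / 3 * c + 1ℚ * (pos 1 / 4 * d + 1ℚ * (pos 1 / 5 * e))))))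
    - K * (0ℚ * (a + 0ℚ * (½ * b + 0ℚ * (pos 1 / 3 * c + 0ℚ * (pos 1 / 4 * d + 0ℚ * (pos 1 / 5 * e))))))
    ≡ K * (a + ½ * b + pos 1 / 3 * c + pos 1 / 4 * d + pos 1 / 5 * e)
  evaluate = solve-∀ ℚ-ring

-- Comparison of the two probabilities for n = b + m + 1.

module _ (b′ m : ℕ) where
  private
    b  = suc b′
    n′ = b′ ℕ.+ suc m
    n  = suc n′
    B  = ℕ→ℚ b
    L  = ℕ→ℚ (suc m)
    c  = ℕ→ℚ (n C b)
    α  = recip b′
    γ  = recip m
    ν  = recip n′

    Q : ℚ → ℚ
    Q u = (B + u) * ν

    α-eq : B * α ≡ 1ℚ
    α-eq = suc*recip b′
    γ-eq : L * γ ≡ 1ℚ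
    γ-eq = suc*recip m
    ν-eq : (B + L) * ν ≡ 1ℚ
    ν-eq = trans (cong (_* ν) (sym (ℕ→ℚ-+ b (suc m)))) (suc*recip n′)

    -- This and `1-Q≡` pull b/n and (m + 1)/n out of the success and failure probabilities, leaving
    -- exactly the two bases of `density`.
    Q≡ : ∀ u → Q u ≡ B * ν * (1ℚ + α * u)
    Q≡ u = ≡-modulo (- (ν * u)) 0ℚ α-eq γ-eq (identity α γ ν B L u)
      where
      identity : ∀ α γ ν B L u → (B + u) * ν
        ≡ B * ν * (1ℚ + α * u) + - (ν * u) * (B * α - 1ℚ) + 0ℚ * (L * γ - 1ℚ)
      identity = solve-∀ ℚ-ring

    1-Q≡ : ∀ u → 1ℚ - Q u ≡ L * ν * (1ℚ - γ * u)
    1-Q≡ u = ≡-modulo (ν * u) (- 1ℚ) γ-eq ν-eq (identity γ ν B L u)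
      where
      identity : ∀ γ ν B L u → 1ℚ - (B + u) * ν
        ≡ L * ν * (1ℚ - γ * u) + ν * u * (L * γ - 1ℚ) + - 1ℚ * ((B + L) * ν - 1ℚ)
      identity = solve-∀ ℚ-ring

    K : ℚ
    K = binomPmf n (pos b / n) b

    K≡ : K ≡ c * ((B * ν) ^ℚ b * (L * ν) ^ℚ suc m)
    K≡ = begin
      c * ((pos b / n) ^ℚ b * (1ℚ - pos b / n) ^ℚ (n ℕ.∸ b))
        ≡⟨ cong₂ (λ x e → c * (x ^ℚ b * (1ℚ - x) ^ℚ e)) (/≡*recip b n′) (ℕ.m+n∸m≡n b (suc m)) ⟩
      c * ((B * ν) ^ℚ b * (1ℚ - B * ν) ^ℚ suc m)
        ≡⟨ cong (λ x → c * ((B * ν) ^ℚ b * x ^ℚ suc m)) 1-Bν≡Lν ⟩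
      c * ((B * ν) ^ℚ b * (L * ν) ^ℚ suc m) ∎
      where
      open ≡-Reasoning
      1-Bν≡Lν : 1ℚ - B * ν ≡ L * ν
      1-Bν≡Lν = trans (cong (_- B * ν) (sym ν-eq)) (identity ν B L)
        where
        identity : ∀ ν B L → (B + L) * ν - B * ν ≡ L * ν
        identity = solve-∀ ℚ-ring

    0<K : 0ℚ < K
    0<K = subst (0ℚ <_) (sym K≡) (0<* (0<ℕ→ℚ (n C b) {{ℕ.>-nonZero (0<nCk b (suc m))}})
      (0<* (0<^ (0<* (0<ℕ→ℚ b) (0<recip n′)) b) (0<^ (0<* (0<ℕ→ℚ (suc m)) (0<recip n′)) (suc m))))

    Φ : ℚ → ℚ
    Φ u = sumBelow (suc b) (binomPmf n (Q u))

    -- The minus sign makes the derivative a positive multiple of the density. The factor (m + 1)/n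
    -- from `deriv-cdf` raises the failure power from m to m + 1, which completes K.
    dΦ : Deriv (λ u → - 1ℚ * Φ u) (λ u → K * density b′ m u)
    dΦ = deriv-cong (deriv-scale (- 1ℚ) (deriv-cdf dQ b m refl)) (λ _ → refl) λ u → begin
      - 1ℚ * - (L * c * (Q u ^ℚ b * (1ℚ - Q u) ^ℚ m) * ν)
        ≡⟨ cong₂ (λ x y → - 1ℚ * - (L * c * (x ^ℚ b * y ^ℚ m) * ν)) (Q≡ u) (1-Q≡ u) ⟩
      - 1ℚ * - (L * c * ((B * ν * (1ℚ + α * u)) ^ℚ b * (L * ν * (1ℚ - γ * u)) ^ℚ m) * ν)
        ≡⟨ cong₂ (λ x y → - 1ℚ * - (L * c * (x * y) * ν))
             (^-distrib-* (B * ν) (1ℚ + α * u) b) (^-distrib-* (L * ν) (1ℚ - γ * u) m) ⟩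
      - 1ℚ * - (L * c * ((B * ν) ^ℚ b * (1ℚ + α * u) ^ℚ b * ((L * ν) ^ℚ m * (1ℚ - γ * u) ^ℚ m)) * ν)
        ≡⟨ regroup L c ν ((B * ν) ^ℚ b) ((1ℚ + α * u) ^ℚ b) ((L * ν) ^ℚ m) ((1ℚ - γ * u) ^ℚ m) ⟩
      c * ((B * ν) ^ℚ b * (L * ν) ^ℚ suc m) * density b′ m u
        ≡⟨ cong (_* density b′ m u) K≡ ⟨
      K * density b′ m u ∎
      where
      open ≡-Reasoning
      dQ : Deriv Q (λ _ → ν)
      dQ = deriv-cong (deriv-* (deriv-+ (deriv-const B) deriv-id) (deriv-const ν)) (λ _ → refl)
        (λ u → simplify ν (B + u))
        where
        simplify : ∀ ν x → (0ℚ + 1ℚ) * ν + x * 0ℚ ≡ ν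
        simplify = solve-∀ ℚ-ring
      regroup : ∀ L c ν x w y v → - 1ℚ * - (L * c * (x * w * (y * v)) * ν) ≡ c * (x * (L * ν * y)) * (w * v)
      regroup = solve-∀ ℚ-ring

    -- The sum defining Φ runs up to index b inclusive, one term beyond p_{b,n}; at u = 1 the same
    -- range is exactly that of p_{b+1,n}.
    Φ0≡ : Φ 0ℚ ≡ p b n + K
    Φ0≡ = cong (λ q → sumBelow (suc b) (binomPmf n q))
      (trans (cong (_* ν) (+-identityʳ B)) (sym (/≡*recip b n′)))

    Φ1≡ : Φ 1ℚ ≡ p (suc b) n
    Φ1≡ = cong (λ q → sumBelow (suc b) (binomPmf n q))
      (trans (cong (_* ν) (trans (+-comm B 1ℚ) (sym (ℕ→ℚ-suc b)))) (sym (/≡*recip (suc b) n′)))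

    Δ≡ : - 1ℚ * Φ 1ℚ - - 1ℚ * Φ 0ℚ ≡ p b n + K - p (suc b) n
    Δ≡ = trans (cong₂ (λ x y → - 1ℚ * x - - 1ℚ * y) Φ1≡ Φ0≡) (regroup (p (suc b) n) (p b n + K))
      where
      regroup : ∀ x y → - 1ℚ * x - - 1ℚ * y ≡ y - x
      regroup = solve-∀ ℚ-ring

  p-decreasing : m ℕ.≤ b ℕ.+ b → p (suc b) n < p b n
  p-decreasing m≤2b = <-by
    (0<+ (0<* 0<K (0<* (positive⁻¹ (pos 1 / 12)) (0<* 0<ρ 0<ρ))) (0≤y-x K∫≤))
    (regroup (p b n) (p (suc b) n) K ρ)
    where
    ρ = recip (b ℕ.+ b)
    c₂ = - (½ * (ρ * (pos 3 / 1 + ρ)))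
    0<ρ = 0<recip (b ℕ.+ b)
    K∫≤ : K * (1ℚ + pos 1 / 12 * (ρ * ρ)) ≤ p b n + K - p (suc b) n
    K∫≤ = subst₂ _≤_ (trans (Δ-antiderivative K 1ℚ ρ c₂ (ρ * ρ) 0ℚ) (cong (K *_) (identity ρ))) Δ≡
      (F′≤G′⇒ΔF≤ΔG (deriv-scale K (deriv-antiderivative 1ℚ ρ c₂ (ρ * ρ) 0ℚ)) dΦ
        λ u 0≤u u≤1 → *-monoˡ-≤-nonNeg K {{nonNegative (<⇒≤ 0<K)}}
          (≤-trans (lower≤density b′ 0≤u u≤1) (density-antitone b′ m≤2b 0≤u u≤1)))
      where
      -- The linear terms cancel, so order ρ² decides: 1/4 - 1/6 = 1/12.
      identity : ∀ ρ → 1ℚ + ½ * ρ + pos 1 / 3 * - (½ * (ρ * (pos 3 / 1 + ρ))) + pos 1 / 4 * (ρ * ρ) + pos 1 / 5 * 0ℚ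
        ≡ 1ℚ + pos 1 / 12 * (ρ * ρ)
      identity = solve-∀ ℚ-ring
    regroup : ∀ x y K ρ → y + (K * (pos 1 / 12 * (ρ * ρ)) + (x + K - y - K * (1ℚ + pos 1 / 12 * (ρ * ρ)))) ≡ x
    regroup = solve-∀ ℚ-ring

  p-increasing : suc (b ℕ.+ b) ℕ.≤ m → p b n < p (suc b) n
  p-increasing 2b+1≤m = <-by
    (0<+ (0<* 0<K (0<* (0<* 0<κ 0<κ)
           (0<+ (positive⁻¹ (pos 1 / 24)) (0≤* (nonNegative⁻¹ (pos 1 / 20)) (0≤y-x (recip≤1 (suc (b ℕ.+ b))))))))
         (0≤y-x ≤K∫))
    (regroup (p b n) (p (suc b) n) K κ)
    where
    κ = recip (suc (b ℕ.+ b))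
    c₂ = κ * κ - pos 3 / 2 * κ
    c₃ = κ * κ * (κ - pos 7 / 2)
    c₄ = κ * κ * (pos 9 / 4 - κ)
    0<κ = 0<recip (suc (b ℕ.+ b))
    ≤K∫ : p b n + K - p (suc b) n ≤ K * (1ℚ - κ * κ * (pos 1 / 24 + pos 1 / 20 * (1ℚ - κ)))
    ≤K∫ = subst₂ _≤_ Δ≡ (trans (Δ-antiderivative K 1ℚ κ c₂ c₃ c₄) (cong (K *_) (identity κ)))
      (F′≤G′⇒ΔF≤ΔG dΦ (deriv-scale K (deriv-antiderivative 1ℚ κ c₂ c₃ c₄))
        λ u 0≤u u≤1 → *-monoˡ-≤-nonNeg K {{nonNegative (<⇒≤ 0<K)}}
          (≤-trans (density-antitone b′ 2b+1≤m 0≤u u≤1) (density≤upper b′ 0≤u u≤1)))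
      where
      -- Again the linear terms cancel. What remains, -11κ²/120 + κ³/20, is split so that its sign
      -- follows from κ ≤ 1.
      identity : ∀ κ → 1ℚ + ½ * κ + pos 1 / 3 * (κ * κ - pos 3 / 2 * κ)
        + pos 1 / 4 * (κ * κ * (κ - pos 7 / 2)) + pos 1 / 5 * (κ * κ * (pos 9 / 4 - κ))
        ≡ 1ℚ - κ * κ * (pos 1 / 24 + pos 1 / 20 * (1ℚ - κ))
      identity = solve-∀ ℚ-ring
    regroup : ∀ x y K κ → x + (K * (κ * κ * (pos 1 / 24 + pos 1 / 20 * (1ℚ - κ)))
      + (K * (1ℚ - κ * κ * (pos 1 / 24 + pos 1 / 20 * (1ℚ - κ))) - (x + K - y))) ≡ y
    regroup = solve-∀ ℚ-ring

theorem3 : (b n : ℕ) → 1 ℕ.≤ b → b ℕ.+ 1 ℕ.≤ n →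
    ((n ℕ.≥ 3 ℕ.* b ℕ.+ 2 → p (suc b) n > p b n) ×
    (n ℕ.≤ 3 ℕ.* b ℕ.+ 1 → p (suc b) n < p b n))
theorem3 b@(suc b′) n _ b+1≤n with ∃m b+1≤n
  where
  ∃m : b ℕ.+ 1 ℕ.≤ n → ∃ λ m → b ℕ.+ suc m ≡ n
  ∃m b+1≤n = let m , eq = ℕ.m≤n⇒∃[o]m+o≡n b+1≤n in m , trans (sym (ℕ.+-assoc b 1 m)) eq
... | m , refl =
  -- With n = b + m + 1, cancelling b + 1 turns the two conditions on n into m ≥ 2b + 1 and m ≤ 2b.
  (λ 3b+2≤n → p-increasing b′ m (ℕ.+-cancelˡ-≤ (suc b) _ _ (subst₂ ℕ._≤_ (3b+2≡ b) (ℕ.+-suc b m) 3b+2≤n))) ,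
  (λ n≤3b+1 → p-decreasing b′ m (ℕ.+-cancelˡ-≤ (suc b) _ _ (subst₂ ℕ._≤_ (ℕ.+-suc b m) (3b+1≡ b) n≤3b+1)))
  where
  3b+2≡ : ∀ b → 3 ℕ.* b ℕ.+ 2 ≡ suc b ℕ.+ suc (b ℕ.+ b)
  3b+2≡ = ℕ-Solver.solve-∀
  3b+1≡ : ∀ b → 3 ℕ.* b ℕ.+ 1 ≡ suc b ℕ.+ (b ℕ.+ b)
  3b+1≡ = ℕ-Solver.solve-∀
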